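{- Let $D$ be an oriented graph on $n$ vertices. If $d^-(v)+\omega^+(v)\geq n/2$ for every vertex $v\in V(D)$, then either $D$ contains a directed triangle, or $n$ is even and $D$ is an orientation of the complete bipartite graph $K_{n/2,n/2}$.
   Context: All graphs are simple and finite. An orientation of an undirected simple graph is a digraph obtained from it by replacing each edge with exactly one of the two possible arcs with the same ends; such a digraph is called an oriented graph. For a vertex $v$ of $D$, $d^-(v)$ is the in-degree of $v$, $N^+(v)$ is the set of out-neighbors of $v$, $D[N^+(v)]$ is the subdigraph of $D$ induced by $N^+(v)$, and the out-component number $\omega^+(v)$ is the number of components of $D[N^+(v)]$, where components are the connected components of the underlying undirected graph (so $\omega^+(v)=0$ if $N^+(v)=\emptyset$). A directed triangle is a directed cycle of length 3. -}

module Defs where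

open import Data.Bool using (Bool; T)
open import Data.Bool.Properties using (T?)
open import Data.Empty using (⊥)
open import Data.Fin using (Fin; zero; suc; punchIn; punchOut; _≟_)
open import Data.Fin.Properties
  using (punchInᵢ≢i; punchIn-punchOut; punchOut-punchIn; punchOut-cong)
open import Data.Fin.Subset using (Subset; inside; outside; _∈_; ∣_∣)
open import Data.List using (List; []; _∷_; map; allFin; filter; cartesianProduct)
import Data.List.Membership.Propositional as List
open import Data.List.Membership.Propositional.Properties
  using (∈-map⁺; ∈-allFin; ∈-cartesianProduct⁺; ∈-filter⁺; ∈-filter⁻)
open import Data.List.Relation.Unary.Any using (here; there)
open import Data.Nat using (ℕ; zero; suc)
open import Data.Product using (∃; _×_; _,_; proj₁; proj₂; uncurry)
open import Data.Sum using (_⊎_; inj₁; inj₂)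
open import Data.Unit using (⊤; tt)
open import Data.Vec as Vec using (tabulate)
open import Function using (_∘_; _↔_; _⇔_; Inverse; mk↔ₛ′)
open import Level using (0ℓ)
open import Relation.Binary using (Rel; Setoid; Symmetric; Irreflexive; Decidable)
open import Relation.Binary.Construct.Closure.Equivalence as EqC using (EqClosure)
open import Relation.Binary.PropositionalEquality
  using (_≡_; _≢_; refl; sym; trans; cong; subst)
import Relation.Binary.PropositionalEquality as ≡
open import Relation.Nullary using (¬_; Dec; yes; no; contradiction)

------------------------------------------------------------------------
-- Undirected simple graphs

record SimpleGraph (V : Set) : Set₁ where
  field
    Adj        : Rel V 0ℓ
    adj-sym    : Symmetric Adj
    adj-irrefl : Irreflexive _≡_ Adj

infix 4 _≅_

record _≅_ {V W : Set} (G : SimpleGraph V) (H : SimpleGraph W) : Set where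
  private
    module G = SimpleGraph G
    module H = SimpleGraph H
  field
    vertices : V ↔ W
  open Inverse vertices public using (to; from)
  field
    adj : ∀ u v → G.Adj u v ⇔ H.Adj (to u) (to v)

module _ (a b : ℕ) where

  private
    Across : Rel (Fin a ⊎ Fin b) 0ℓ
    Across (inj₁ _) (inj₁ _) = ⊥
    Across (inj₁ _) (inj₂ _) = ⊤
    Across (inj₂ _) (inj₁ _) = ⊤
    Across (inj₂ _) (inj₂ _) = ⊥

    across-sym : Symmetric Across
    across-sym {inj₁ _} {inj₂ _} _ = tt
    across-sym {inj₂ _} {inj₁ _} _ = tt

    across-irrefl : Irreflexive _≡_ Across
    across-irrefl {inj₁ _} refl ()
    across-irrefl {inj₂ _} refl ()

  K : SimpleGraph (Fin a ⊎ Fin b)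
  K = record { Adj = Across ; adj-sym = across-sym ; adj-irrefl = across-irrefl }

------------------------------------------------------------------------
-- Digraphs and orientations

record Digraph (V : Set) : Set where
  field
    arc : V → V → Bool

  Arc : Rel V 0ℓ
  Arc u v = T (arc u v)

open Digraph public

infix 4 _IsOrientationOf_

record _IsOrientationOf_ {V : Set} (D : Digraph V) (G : SimpleGraph V) : Set where
  open SimpleGraph G using (Adj)
  field
    arc⇒edge : ∀ {u v} → Arc D u v → Adj u v
    edge⇒arc : ∀ {u v} → Adj u v →
               (Arc D u v × ¬ Arc D v u) ⊎ (¬ Arc D u v × Arc D v u)

Oriented : {V : Set} → Digraph V → Set₁
Oriented D = ∃ λ G → D IsOrientationOf G

-- Being an orientation of a specific graph such as K a b is meant up to
-- isomorphism of the underlying graph.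
OrientationOfCopy : {V W : Set} → Digraph V → SimpleGraph W → Set₁
OrientationOfCopy D H = ∃ λ G → D IsOrientationOf G × G ≅ H

HasDirectedTriangle : {V : Set} → Digraph V → Set
HasDirectedTriangle D = ∃ λ u → ∃ λ v → ∃ λ w →
  (u ≢ v × v ≢ w × w ≢ u) × Arc D u v × Arc D v w × Arc D w u

module _ {n : ℕ} (D : Digraph (Fin n)) where

  N⁺ N⁻ : Fin n → Subset n
  N⁺ v = tabulate λ u → arc D v u
  N⁻ v = tabulate λ u → arc D u v

  d⁻ : Fin n → ℕ
  d⁻ v = ∣ N⁻ v ∣

infix 8 _[_]

_[_] : {n : ℕ} → Digraph (Fin n) → (S : Subset n) → Digraph (∃ (_∈ S))
arc (D [ S ]) (u , _) (w , _) = arc D u w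

------------------------------------------------------------------------
-- Components

-- EqClosure R is Star (SymClosure R), so two vertices are related exactly
-- when a walk in the underlying undirected graph joins them.  Lacking
-- quotients, the set of components is the setoid of vertices under this
-- relation.
Components : {V : Set} → Digraph V → Setoid 0ℓ 0ℓ
Components D = EqC.setoid (Arc D)

HasCardinality : Setoid 0ℓ 0ℓ → ℕ → Set
HasCardinality S k = Inverse S (≡.setoid (Fin k))

-- Existence of the number of components of a finite digraph: start from
-- isolated vertices and merge classes while adding the arcs one by one.
private
  module _ {V : Set} where

    InList : List (V × V) → Rel V 0ℓ
    InList es u v = (u , v) List.∈ es

    record Classes (R : Rel V 0ℓ) (k : ℕ) : Set where
      field
        class     : V → Fin k
        rep       : Fin k → V
        class-rep : ∀ i → class (rep i) ≡ i
        sound     : ∀ {u v} → R u v → class u ≡ class v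
        complete  : ∀ u → EqClosure R u (rep (class u))

    open Classes

    module Merge {k} (p q : Fin (suc k)) (q≢p : q ≢ p) where

      merge′ : ∀ i → Dec (q ≡ i) → Fin k
      merge′ i (yes _)  = punchOut q≢p
      merge′ i (no q≢i) = punchOut q≢i

      merge : Fin (suc k) → Fin k
      merge i = merge′ i (q ≟ i)

      merge-eq : merge p ≡ merge q
      merge-eq with q ≟ p | q ≟ q
      ... | yes _ | yes _  = refl
      ... | no _  | yes _  = punchOut-cong q refl
      ... | _     | no q≢q = contradiction refl q≢q

      merge-punchIn : ∀ i → merge (punchIn q i) ≡ i
      merge-punchIn i with q ≟ punchIn q i
      ... | yes eq = contradiction (sym eq) (punchInᵢ≢i q i)
      ... | no _   = trans (punchOut-cong q refl) (punchOut-punchIn q)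

      punchIn-merge : ∀ i → (q ≡ i × punchIn q (merge i) ≡ p)
                          ⊎ punchIn q (merge i) ≡ i
      punchIn-merge i with q ≟ i
      ... | yes eq = inj₁ (eq , punchIn-punchOut q≢p)
      ... | no q≢i = inj₂ (punchIn-punchOut q≢i)

    addArc : ∀ {es k} a b → Classes (InList es) k →
             ∃ (Classes (InList ((a , b) ∷ es)))
    addArc {k = zero} a b C with () ← class C a
    addArc {es} {suc k} a b C with class C b ≟ class C a
    ... | yes eq = suc k , record
      { class     = class C
      ; rep       = rep C
      ; class-rep = class-rep C
      ; sound     = λ where
          (here refl) → sym eq
          (there e)   → sound C e
      ; complete  = λ u → EqC.map there (complete C u)
      }
    ... | no b≢a = k , record
      { class     = merge ∘ class C
      ; rep       = rep C ∘ punchIn (class C b)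
      ; class-rep = λ i → trans (cong merge (class-rep C _)) (merge-punchIn i)
      ; sound     = λ where
          (here refl) → merge-eq
          (there e)   → cong merge (sound C e)
      ; complete  = complete′
      }
      where
      open Merge (class C a) (class C b) b≢a
      es′ = InList ((a , b) ∷ es)
      old : ∀ u → EqClosure es′ u (rep C (class C u))
      old u = EqC.map there (complete C u)
      complete′ : ∀ u → EqClosure es′ u (rep C (punchIn (class C b) (merge (class C u))))
      complete′ u with punchIn-merge (class C u)
      ... | inj₂ eq       rewrite eq = old u
      ... | inj₁ (bu , eq) rewrite eq =
        EqC.transitive es′ (subst (EqClosure es′ u ∘ rep C) (sym bu) (old u))
        (EqC.transitive es′ (EqC.symmetric es′ (old b))
        (EqC.transitive es′ (EqC.symmetric es′ (EqC.return (here refl))) (old a)))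

    fromList : ∀ {m} → V ↔ Fin m → ∀ es → ∃ (Classes (InList es))
    fromList {m} V↔m [] = m , record
      { class     = to
      ; rep       = from
      ; class-rep = strictlyInverseˡ
      ; sound     = λ ()
      ; complete  = λ u → subst (EqClosure (InList []) u)
                            (sym (strictlyInverseʳ u)) (EqC.reflexive (InList []))
      }
      where open Inverse V↔m
    fromList V↔m ((a , b) ∷ es) = addArc a b (proj₂ (fromList V↔m es))

    classes : ∀ {m} {R : Rel V 0ℓ} → V ↔ Fin m → Decidable R →
              ∃ λ k → HasCardinality (EqC.setoid R) k
    classes {m} {R} V↔m R? = proj₁ C , record
      { to        = class (proj₂ C)
      ; from      = rep (proj₂ C)
      ; to-cong   = to-cong
      ; from-cong = λ { refl → EqC.reflexive R }
      ; inverse   = (λ {i} u≈ → trans (to-cong u≈) (class-rep (proj₂ C) i))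
                  , (λ { {u} refl → EqC.symmetric R (EqC.map fromArcs (complete (proj₂ C) u)) })
      }
      where
      vs : List V
      vs = map (Inverse.from V↔m) (allFin m)

      arcs : List (V × V)
      arcs = filter (uncurry R?) (cartesianProduct vs vs)

      C : ∃ (Classes (InList arcs))
      C = fromList V↔m arcs

      ∈-vs : ∀ v → v List.∈ vs
      ∈-vs v = subst (List._∈ vs) (Inverse.strictlyInverseʳ V↔m v)
                 (∈-map⁺ (Inverse.from V↔m) (∈-allFin (Inverse.to V↔m v)))

      toArcs : ∀ {u v} → R u v → InList arcs u v
      toArcs r = ∈-filter⁺ (uncurry R?) (∈-cartesianProduct⁺ (∈-vs _) (∈-vs _)) r

      fromArcs : ∀ {u v} → InList arcs u v → R u v
      fromArcs e = proj₂ (∈-filter⁻ (uncurry R?) {xs = cartesianProduct vs vs} e)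

      to-cong : ∀ {u v} → EqClosure R u v → class (proj₂ C) u ≡ class (proj₂ C) v
      to-cong = EqC.gfold ≡.isEquivalence (class (proj₂ C)) (sound (proj₂ C) ∘ toArcs)

  ∈↔Fin : ∀ {n} (S : Subset n) → ∃ (_∈ S) ↔ Fin ∣ S ∣
  ∈↔Fin Vec.[] = mk↔ₛ′ (λ ()) (λ ()) (λ ()) (λ ())
  ∈↔Fin (inside Vec.∷ S) = mk↔ₛ′ f g fg gf
    where
    open Inverse (∈↔Fin S)
    f : ∃ (_∈ inside Vec.∷ S) → Fin (suc ∣ S ∣)
    f (_ , Vec.here)    = zero
    f (_ , Vec.there p) = suc (to (_ , p))
    g : Fin (suc ∣ S ∣) → ∃ (_∈ inside Vec.∷ S)
    g zero    = zero , Vec.here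
    g (suc i) = suc (proj₁ (from i)) , Vec.there (proj₂ (from i))
    fg : ∀ i → f (g i) ≡ i
    fg zero    = refl
    fg (suc i) = cong suc (strictlyInverseˡ i)
    gf : ∀ x → g (f x) ≡ x
    gf (_ , Vec.here)    = refl
    gf (_ , Vec.there p) = cong (λ (u , q) → suc u , Vec.there q) (strictlyInverseʳ (_ , p))
  ∈↔Fin (outside Vec.∷ S) = mk↔ₛ′ f g strictlyInverseˡ gf
    where
    open Inverse (∈↔Fin S)
    f : ∃ (_∈ outside Vec.∷ S) → Fin ∣ S ∣
    f (_ , Vec.there p) = to (_ , p)
    g : Fin ∣ S ∣ → ∃ (_∈ outside Vec.∷ S)
    g i = suc (proj₁ (from i)) , Vec.there (proj₂ (from i))
    gf : ∀ x → g (f x) ≡ x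
    gf (_ , Vec.there p) = cong (λ (u , q) → suc u , Vec.there q) (strictlyInverseʳ (_ , p))

module _ {n : ℕ} (D : Digraph (Fin n)) where

  outComponents : ∀ v → ∃ λ k → HasCardinality (Components (D [ N⁺ D v ])) k
  outComponents v = classes (∈↔Fin (N⁺ D v)) (λ _ _ → T? _)

  ω⁺ : Fin n → ℕ
  ω⁺ v = proj₁ (outComponents v)

{-# OPTIONS --safe #-}
module Submission where

open import Defs
open import Data.Fin using (Fin)
open import Data.Nat using (ℕ; _+_; _*_; _≤_; _/_)
open import Data.Nat.Divisibility using (_∣_)
open import Data.Product using (_×_)
open import Data.Sum using (_⊎_)
open import Data.Bool using (Bool; true; false; T; _∨_)
open import Data.Bool.Properties using (T?; T-≡; T-∨)
open import Data.Fin using (zero; suc; toℕ; punchIn; _≟_)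
open import Data.Fin.Properties using (any?; punchInᵢ≢i; suc-injective; pigeonhole)
open import Data.Fin.Subset using (Subset; inside; outside; _∈_; _∉_; _⊆_; ∣_∣; ∁; _-_)
open import Data.Fin.Subset.Properties
  using (_∈?_; p⊆q⇒∣p∣≤∣q∣; p⊂q⇒∣p∣<∣q∣; ∣∁p∣≡n∸∣p∣; ∣p∣≤n; x∉p⇒x∈∁p;
         x∈p∧x≢y⇒x∈p-y; x∈p⇒∣p-x∣<∣p∣)
open import Data.Nat using (zero; suc; z≤n; s≤s; _<_; _∸_)
open import Data.Nat.Divisibility using (divides)
open import Data.Nat.DivMod using (m*n/n≡m)
open import Data.Nat.Properties hiding (_≟_; suc-injective)
open import Algebra.Properties.Semiring.Sum +-*-semiring
  using (sum; sum-cong-≗; ∑-distrib-+; ∑-comm; *-distribˡ-sum)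
open import Data.Product using (∃; _,_; proj₁; proj₂; map₂)
open import Data.Sum using (inj₁; inj₂; [_,_]′; swap) renaming (map to ⊎-map)
open import Data.Vec using (Vec; []; _∷_; here; there; tabulate; lookup)
open import Data.Vec.Properties using ([]=⇒lookup; lookup⇒[]=; lookup∘tabulate)
open import Data.Vec.Properties.WithK using ([]=-irrelevant)
open import Function using (id; _∘_; _↔_; _⇔_; Inverse; Equivalence; mk↔ₛ′; mk⇔)
open import Function.Definitions using (Injective)
import Relation.Binary.Construct.Closure.Equivalence as EqC
open import Relation.Binary.PropositionalEquality
  using (_≡_; _≢_; refl; sym; trans; cong; subst; subst₂; module ≡-Reasoning)
open import Relation.Nullary using (¬_; isYes; yes; no; contradiction)
open import Relation.Nullary.Decidable using (toWitness; fromWitness; _×-dec_)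

-- Write s(v) = d⁺(v) − ω(v), and for an arc u → v let t₁, t₂, t₃ be the
-- numbers of common neighbours x with u ← x → v, u → x → v and u → x ← v.
-- Picking one vertex from every component of D[N⁺(u)], with v for its own,
-- gives ω(u) out-neighbours of u that are not adjacent to v.  Counting
-- vertices around the arc then shows s(v) ≤ t₁, and counting in N⁺(u) alone
-- shows t₂ + t₃ ≤ s(u).  Take v with in-neighbours and s(v) maximal.  As t₁
-- and t₂ have the same sum over the in-neighbours u of v, if s(v) > 0 then
-- all of these also attain the maximum and have t₃ = 0; but an arc x → v has
-- a common in-neighbour w, and v is counted by t₃ for w → x.  So s vanishes
-- off the sources, and no transitive triangle begins at a nonsource.
-- One that begins at a source u makes some component of D[N⁺(u)] nontrivial,
-- and comparing with a different component gains one vertex in the first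
-- count, a contradiction.  Hence D is triangle-free with all degrees
-- at least n/2.

-- Finite sums, Boolean indicators and sizes of subsets.

sum-mono : ∀ {n} {f g : Fin n → ℕ} → (∀ i → f i ≤ g i) → sum f ≤ sum g
sum-mono {zero}  f≤g = z≤n
sum-mono {suc n} f≤g = +-mono-≤ (f≤g zero) (sum-mono (f≤g ∘ suc))

-- A strict gap in one term could not be made up by the others, so reversing the inequality between
-- the totals reverses it in every term.
sum-squeeze : ∀ {n} {f g : Fin n → ℕ} → (∀ i → f i ≤ g i) → sum g ≤ sum f → ∀ i → g i ≤ f i
sum-squeeze {suc n} {f} {g} f≤g Σg≤Σf zero = +-cancelʳ-≤ (sum (g ∘ suc)) (g zero) (f zero)
  (≤-trans Σg≤Σf (+-monoʳ-≤ (f zero) (sum-mono (f≤g ∘ suc))))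
sum-squeeze {suc n} {f} {g} f≤g Σg≤Σf (suc i) = sum-squeeze (f≤g ∘ suc)
  (+-cancelˡ-≤ (f zero) _ _ (≤-trans (+-monoˡ-≤ _ (f≤g zero)) Σg≤Σf)) i

sum-positive : ∀ {n} (f : Fin n → ℕ) → 0 < sum f → ∃ λ i → 0 < f i
sum-positive {suc n} f 0<Σ with f zero in eq
... | zero  = let i , 0<fi = sum-positive (f ∘ suc) 0<Σ in suc i , 0<fi
... | suc m = zero , subst (0 <_) (sym eq) (s≤s z≤n)

term≤sum : ∀ {n} (f : Fin n → ℕ) i → f i ≤ sum f
term≤sum f zero    = m≤m+n _ _
term≤sum f (suc i) = ≤-trans (term≤sum (f ∘ suc) i) (m≤n+m _ _)

sum-1 : ∀ n → sum {n} (λ _ → 1) ≡ n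
sum-1 zero    = refl
sum-1 (suc n) = cong suc (sum-1 n)

⟦_⟧ : Bool → ℕ
⟦ true ⟧  = 1
⟦ false ⟧ = 0

⟦⟧-positive : ∀ {b} → 0 < ⟦ b ⟧ → T b
⟦⟧-positive {true} _ = _

∣tabulate∣ : ∀ {n} (b : Fin n → Bool) → ∣ tabulate b ∣ ≡ sum (⟦_⟧ ∘ b)
∣tabulate∣ {zero}  b = refl
∣tabulate∣ {suc n} b with b zero
... | true  = cong suc (∣tabulate∣ (b ∘ suc))
... | false = ∣tabulate∣ (b ∘ suc)

∈-tabulate⁺ : ∀ {n} {b : Fin n → Bool} {x} → T (b x) → x ∈ tabulate b
∈-tabulate⁺ {b = b} {x} t =
  lookup⇒[]= x _ (trans (lookup∘tabulate b x) (Equivalence.to T-≡ t))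

∈-tabulate⁻ : ∀ {n} {b : Fin n → Bool} {x} → x ∈ tabulate b → T (b x)
∈-tabulate⁻ {b = b} {x} x∈ =
  Equivalence.from T-≡ (trans (sym (lookup∘tabulate b x)) ([]=⇒lookup x∈))

injection⇒≤ : ∀ {m n} {S : Subset n} (h : Fin m → Fin n) →
  Injective _≡_ _≡_ h → (∀ i → h i ∈ S) → m ≤ ∣ S ∣
injection⇒≤ {zero}  h inj h∈S = z≤n
injection⇒≤ {suc m} {S = S} h inj h∈S = ≤-trans
  (s≤s (injection⇒≤ {S = S - h zero} (h ∘ suc) (suc-injective ∘ inj)
    (λ i → x∈p∧x≢y⇒x∈p-y (h∈S (suc i)) (λ eq → contradiction (inj eq) λ ()))))
  (x∈p⇒∣p-x∣<∣p∣ (h∈S zero))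

⊆∧≥⇒⊇ : ∀ {n} {p q : Subset n} → p ⊆ q → ∣ q ∣ ≤ ∣ p ∣ → q ⊆ p
⊆∧≥⇒⊇ {p = p} p⊆q ∣q∣≤∣p∣ {x} x∈q with x ∈? p
... | yes x∈p = x∈p
... | no  x∉p = contradiction (p⊂q⇒∣p∣<∣q∣ (p⊆q , x , x∈q , x∉p)) (≤⇒≯ ∣q∣≤∣p∣)

-- Adds two lower bounds of n/2 without dividing.
n≤2a∧n≤2b⇒n≤a+b : ∀ {n} a b → n ≤ 2 * a → n ≤ 2 * b → n ≤ a + b
n≤2a∧n≤2b⇒n≤a+b {n} a b n≤2a n≤2b = *-cancelˡ-≤ 2 (begin
  n + (n + 0)    ≡⟨ cong (n +_) (+-identityʳ n) ⟩
  n + n          ≤⟨ +-mono-≤ n≤2a n≤2b ⟩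
  2 * a + 2 * b  ≡⟨ *-distribˡ-+ 2 a b ⟨
  2 * (a + b)    ∎)
  where open ≤-Reasoning

-- Representatives of components that avoid a given vertex.

module _ {n k : ℕ} {S : Subset n} (H : Digraph (Fin n))
         (count : HasCardinality (Components (H [ S ])) k) where

  open Inverse count using (to; from; to-cong; strictlyInverseˡ)

  vertex-≡ : {x y : ∃ (_∈ S)} → proj₁ x ≡ proj₁ y → x ≡ y
  vertex-≡ {_ , p} {_ , q} refl = cong (_ ,_) ([]=-irrelevant p q)

  same-component : ∀ {x y} → Arc (H [ S ]) x y → to x ≡ to y
  same-component e = to-cong (EqC.return e)

  section-injective : (r : Fin k → ∃ (_∈ S)) → (∀ i → to (r i) ≡ i) →
    Injective _≡_ _≡_ (proj₁ ∘ r)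
  section-injective r to∘r {i} {j} eq = begin
    i         ≡⟨ to∘r i ⟨
    to (r i)  ≡⟨ cong to (vertex-≡ eq) ⟩
    to (r j)  ≡⟨ to∘r j ⟩
    j         ∎
    where
    open ≡-Reasoning

  components≤size : k ≤ ∣ S ∣
  components≤size = injection⇒≤ (proj₁ ∘ from) (section-injective from strictlyInverseˡ) (proj₂ ∘ from)

  -- The vertex `v` may itself be a value of `h`. The number `m` is kept apart from the number `k`
  -- of components, because one more vertex than `k` is sometimes available.
  record Avoiding (m : ℕ) (v : Fin n) : Set where
    field
      h         : Fin m → Fin n
      injective : Injective _≡_ _≡_ h
      inside-S  : ∀ i → h i ∈ S
      no-arc-to   : ∀ i → ¬ Arc H (h i) v
      no-arc-from : ∀ i → ¬ Arc H v (h i)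

  module _ (irrefl : ∀ {x} → ¬ Arc H x x) where

    apart : ∀ {x y : ∃ (_∈ S)} → (to x ≡ to y → x ≡ y) →
      ¬ Arc H (proj₁ x) (proj₁ y) × ¬ Arc H (proj₁ y) (proj₁ x)
    apart {x} {y} f = (λ e → irrefl (subst (λ z → Arc H (proj₁ z) _) (f (same-component {x} {y} e)) e))
                    , (λ e → irrefl (subst (λ z → Arc H _ (proj₁ z)) (f (sym (same-component {y} {x} e))) e))

    avoiding : ∀ {v} → v ∈ S → Avoiding k v
    avoiding {v} v∈S = record
      { h = proj₁ ∘ proj₁ ∘ r
      ; injective = section-injective (proj₁ ∘ r) (proj₁ ∘ proj₂ ∘ r)
      ; inside-S = proj₂ ∘ proj₁ ∘ r
      ; no-arc-to = λ i → proj₁ (r-apart i)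
      ; no-arc-from = λ i → proj₂ (r-apart i)
      }
      where
      -- The section `from`, altered at the component of `v` so that `v` represents it; the last
      -- conjunct records this.
      r : ∀ i → ∃ λ x → to x ≡ i × (i ≡ to (v , v∈S) → x ≡ (v , v∈S))
      r i with i ≟ to (v , v∈S)
      ... | yes eq = (v , v∈S) , sym eq , λ _ → refl
      ... | no neq = from i , strictlyInverseˡ i , λ eq → contradiction eq neq
      r-apart : ∀ i → ¬ Arc H (proj₁ (proj₁ (r i))) v × ¬ Arc H v (proj₁ (proj₁ (r i)))
      r-apart i = let _ , to-x , x≡v = r i in apart (λ eq → x≡v (trans (sym to-x) eq))

    -- A component with two vertices contributes one vertex besides its
    -- representative, and both are nonadjacent to any other component.
    avoiding⁺ : ∀ {a b} → a ∈ S → b ∈ S → Arc H a b → 2 ≤ k →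
      ∃ λ v → v ∈ S × Avoiding (suc k) v
    avoiding⁺ {a} {b} a∈S b∈S e 2≤k with to (a , a∈S) in to-a
    ... | c = proj₁ (from j) , proj₂ (from j) , record
      { h = h
      ; injective = h-injective
      ; inside-S = λ { zero → proj₂ z ; (suc i) → proj₂ (from i) }
      ; no-arc-to = λ { zero → proj₁ z-apart ; (suc i) → proj₁ (apart (from-apart i)) }
      ; no-arc-from = λ { zero → proj₂ z-apart ; (suc i) → proj₂ (apart (from-apart i)) }
      }
      where
      another : ∀ {k} → 2 ≤ k → (c : Fin k) → ∃ (_≢ c)
      another {suc zero}    (s≤s ())
      another {suc (suc k)} _ c = punchIn c zero , punchInᵢ≢i c zero
      j : Fin k
      j = proj₁ (another 2≤k c)
      -- Of the two ends of the arc, one that is not the chosen representative of their component.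
      second : ∃ λ z → to z ≡ c × proj₁ z ≢ proj₁ (from c)
      second with proj₁ (from c) ≟ a
      ... | yes eq = (b , b∈S) , trans (sym (same-component {a , a∈S} {b , b∈S} e)) to-a
                   , λ { refl → irrefl (subst (λ x → Arc H x b) (sym eq) e) }
      ... | no neq = (a , a∈S) , to-a , (neq ∘ sym)
      z : ∃ (_∈ S)
      z = proj₁ second
      to-z : to z ≡ c
      to-z = proj₁ (proj₂ second)
      z-apart : ¬ Arc H (proj₁ z) (proj₁ (from j)) × ¬ Arc H (proj₁ (from j)) (proj₁ z)
      z-apart = apart λ eq → contradiction
        (trans (sym (strictlyInverseˡ j)) (trans (sym eq) to-z)) (proj₂ (another 2≤k c))
      from-apart : ∀ i → to (from i) ≡ to (from j) → from i ≡ from j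
      from-apart i eq = cong from (trans (sym (strictlyInverseˡ i)) (trans eq (strictlyInverseˡ j)))
      h : Fin (suc k) → Fin n
      h zero    = proj₁ z
      h (suc i) = proj₁ (from i)
      z≢from : ∀ i → proj₁ z ≢ proj₁ (from i)
      z≢from i eq with i ≟ c
      ... | yes refl = proj₂ (proj₂ second) eq
      ... | no i≢c = i≢c (trans (sym (strictlyInverseˡ i)) (trans (cong to (vertex-≡ (sym eq))) to-z))
      h-injective : Injective _≡_ _≡_ h
      h-injective {zero}  {zero}  _  = refl
      h-injective {zero}  {suc i} eq = contradiction eq (z≢from i)
      h-injective {suc i} {zero}  eq = contradiction (sym eq) (z≢from i)
      h-injective {suc i} {suc j} eq = cong suc (section-injective from strictlyInverseˡ eq)

-- Counting vertices around an arc.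

Disjoint : Bool → Bool → Set
Disjoint p q = T p → T q → T false

-- For an arc u → v and a vertex x, `p`, `q`, `r` stand for x → u, v → x, x → v, and `c` for x being
-- chosen. Only `p` and `r` can hold together, and their product pays for that.
cover≤1+overlap : ∀ p c q r → Disjoint p q → Disjoint q r →
  Disjoint c p → Disjoint c q → Disjoint c r →
  ⟦ p ⟧ + ⟦ c ⟧ + ⟦ q ⟧ + ⟦ r ⟧ ≤ 1 + ⟦ p ⟧ * ⟦ r ⟧
cover≤1+overlap true  true  _     _     pq qr cp cq cr with () ← cp _ _
cover≤1+overlap true  false true  _     pq qr cp cq cr with () ← pq _ _
cover≤1+overlap true  false false true  pq qr cp cq cr = ≤-refl
cover≤1+overlap true  false false false pq qr cp cq cr = ≤-refl
cover≤1+overlap false true  true  _     pq qr cp cq cr with () ← cq _ _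
cover≤1+overlap false true  false true  pq qr cp cq cr with () ← cr _ _
cover≤1+overlap false true  false false pq qr cp cq cr = ≤-refl
cover≤1+overlap false false true  true  pq qr cp cq cr with () ← qr _ _
cover≤1+overlap false false true  false pq qr cp cq cr = ≤-refl
cover≤1+overlap false false false true  pq qr cp cq cr = ≤-refl
cover≤1+overlap false false false false pq qr cp cq cr = z≤n

-- Here `o` stands for u → x. The chosen vertices and those adjacent to v in either direction are
-- three disjoint parts of the out-neighbourhood of u.
disjoint-parts≤whole : ∀ o c r q → (T c → T o) → Disjoint r q →
  Disjoint c r → Disjoint c q →
  ⟦ c ⟧ + ⟦ o ⟧ * ⟦ r ⟧ + ⟦ o ⟧ * ⟦ q ⟧ ≤ ⟦ o ⟧
disjoint-parts≤whole false true  _     _     co rq cr cq with () ← co _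
disjoint-parts≤whole false false _     _     co rq cr cq = z≤n
disjoint-parts≤whole true  true  true  _     co rq cr cq with () ← cr _ _
disjoint-parts≤whole true  true  false true  co rq cr cq with () ← cq _ _
disjoint-parts≤whole true  true  false false co rq cr cq = ≤-refl
disjoint-parts≤whole true  false true  true  co rq cr cq with () ← rq _ _
disjoint-parts≤whole true  false true  false co rq cr cq = ≤-refl
disjoint-parts≤whole true  false false true  co rq cr cq = ≤-refl
disjoint-parts≤whole true  false false false co rq cr cq = z≤n

module Counting {n : ℕ} (D : Digraph (Fin n)) (ω : Fin n → ℕ)
  (components : ∀ v → HasCardinality (Components (D [ N⁺ D v ])) (ω v))
  (asym : ∀ {u v} → Arc D u v → ¬ Arc D v u)
  (no-triangle : ∀ {u v w} → Arc D u v → Arc D v w → ¬ Arc D w u) where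

  irrefl : ∀ {x} → ¬ Arc D x x
  irrefl e = asym e e

  a : Fin n → Fin n → ℕ
  a u v = ⟦ arc D u v ⟧

  d⁻′ d⁺ : Fin n → ℕ
  d⁻′ v = sum λ x → a x v
  d⁺ v = sum λ x → a v x

  t₁ t₂ t₃ : Fin n → Fin n → ℕ
  t₁ u v = sum λ x → a x u * a x v
  t₂ u v = sum λ x → a u x * a x v
  t₃ u v = sum λ x → a u x * a v x

  ω≤d⁺ : ∀ v → ω v ≤ d⁺ v
  ω≤d⁺ v = subst (ω v ≤_) (∣tabulate∣ (arc D v)) (components≤size D (components v))

  Avoid : ℕ → Fin n → Fin n → Set
  Avoid m u v = Avoiding D (components u) m v

  module _ {m u v} (u→v : Arc D u v) (A : Avoid m u v) where
    open Avoiding A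

    image : Fin n → Bool
    image x = isYes (any? λ i → h i ≟ x)

    image⁻ : ∀ {x} → T (image x) → ∃ λ i → h i ≡ x
    image⁻ {x} = toWitness {a? = any? λ i → h i ≟ x}

    m≤∣image∣ : m ≤ sum (⟦_⟧ ∘ image)
    m≤∣image∣ = subst (m ≤_) (∣tabulate∣ image)
      (injection⇒≤ h injective λ i → ∈-tabulate⁺ (fromWitness {a? = any? λ j → h j ≟ h i} (i , refl)))

    image⇒out : ∀ {x} → T (image x) → Arc D u x
    image⇒out t with i , refl ← image⁻ t = ∈-tabulate⁻ (inside-S i)

    image-no-arc-to : ∀ {x} → Disjoint (image x) (arc D x v)
    image-no-arc-to t e with i , refl ← image⁻ t = contradiction e (no-arc-to i)

    image-no-arc-from : ∀ {x} → Disjoint (image x) (arc D v x)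
    image-no-arc-from t e with i , refl ← image⁻ t = contradiction e (no-arc-from i)

    -- The four sets cover a vertex at most once, except that the vertices counted by `t₁` are
    -- covered twice. In-neighbours of `u` and out-neighbours of `v` are disjoint as there is no
    -- directed triangle.
    around-arc : d⁻′ u + m + d⁺ v + d⁻′ v ≤ n + t₁ u v
    around-arc = begin
      d⁻′ u + m + d⁺ v + d⁻′ v
        ≤⟨ +-monoˡ-≤ _ (+-monoˡ-≤ _ (+-monoʳ-≤ (d⁻′ u) m≤∣image∣)) ⟩
      d⁻′ u + sum c + d⁺ v + d⁻′ v
        ≡⟨ cong (λ s → s + d⁺ v + d⁻′ v) (∑-distrib-+ (λ x → a x u) c) ⟨
      sum (λ x → a x u + c x) + d⁺ v + d⁻′ v
        ≡⟨ cong (_+ d⁻′ v) (∑-distrib-+ (λ x → a x u + c x) (a v)) ⟨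
      sum (λ x → a x u + c x + a v x) + d⁻′ v
        ≡⟨ ∑-distrib-+ (λ x → a x u + c x + a v x) (λ x → a x v) ⟨
      sum (λ x → a x u + c x + a v x + a x v)
        ≤⟨ sum-mono (λ x → cover≤1+overlap (arc D x u) (image x) (arc D v x) (arc D x v)
             (λ x→u v→x → no-triangle u→v v→x x→u)
             asym
             (λ t x→u → asym x→u (image⇒out t))
             image-no-arc-from
             image-no-arc-to) ⟩
      sum (λ x → 1 + a x u * a x v)
        ≡⟨ ∑-distrib-+ (λ _ → 1) (λ x → a x u * a x v) ⟩
      sum {n} (λ _ → 1) + t₁ u v
        ≡⟨ cong (_+ t₁ u v) (sum-1 n) ⟩
      n + t₁ u v ∎
      where
      open ≤-Reasoning
      c : Fin n → ℕ
      c = ⟦_⟧ ∘ image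

    inside-out : m + t₂ u v + t₃ u v ≤ d⁺ u
    inside-out = begin
      m + t₂ u v + t₃ u v
        ≤⟨ +-monoˡ-≤ _ (+-monoˡ-≤ _ m≤∣image∣) ⟩
      sum c + t₂ u v + t₃ u v
        ≡⟨ cong (_+ t₃ u v) (∑-distrib-+ c (λ x → a u x * a x v)) ⟨
      sum (λ x → c x + a u x * a x v) + t₃ u v
        ≡⟨ ∑-distrib-+ (λ x → c x + a u x * a x v) (λ x → a u x * a v x) ⟨
      sum (λ x → c x + a u x * a x v + a u x * a v x)
        ≤⟨ sum-mono (λ x → disjoint-parts≤whole (arc D u x) (image x) (arc D x v) (arc D v x)
             image⇒out asym image-no-arc-to image-no-arc-from) ⟩
      d⁺ u ∎
      where
      open ≤-Reasoning
      c : Fin n → ℕ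
      c = ⟦_⟧ ∘ image

-- Consequences of the density condition: surplus, transitive triangles, degrees.

⟦⟧*⟦⟧-positive : ∀ {p q} → 0 < ⟦ p ⟧ * ⟦ q ⟧ → T p × T q
⟦⟧*⟦⟧-positive {true} {true} _ = _

⟦⟧*⟦⟧-true : ∀ {p q} → T p → T q → 1 ≤ ⟦ p ⟧ * ⟦ q ⟧
⟦⟧*⟦⟧-true {true} {true} _ _ = ≤-refl

⟦⟧*-mono : ∀ {b x y} → (T b → x ≤ y) → ⟦ b ⟧ * x ≤ ⟦ b ⟧ * y
⟦⟧*-mono {true}  x≤y = *-monoʳ-≤ 1 (x≤y _)
⟦⟧*-mono {false} x≤y = z≤n

⟦⟧*-cancel : ∀ {b x y} → T b → ⟦ b ⟧ * x ≤ ⟦ b ⟧ * y → x ≤ y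
⟦⟧*-cancel {true} _ = *-cancelˡ-≤ 1

distinct⇒3≤n : ∀ {n} {x y z : Fin n} → x ≢ y → y ≢ z → x ≢ z → 3 ≤ n
distinct⇒3≤n {x = x} {y} {z} x≢y y≢z x≢z = ≮⇒≥ λ n<3 → no-repetition (pigeonhole n<3 (lookup xs))
  where
  xs : Vec _ 3
  xs = x ∷ y ∷ z ∷ []
  no-repetition : ¬ ∃ λ i → ∃ λ j → toℕ i < toℕ j × lookup xs i ≡ lookup xs j
  no-repetition (zero     , suc zero       , _ , eq) = x≢y eq
  no-repetition (zero     , suc (suc zero) , _ , eq) = x≢z eq
  no-repetition (suc zero , suc (suc zero) , _ , eq) = y≢z eq
  no-repetition (suc zero       , suc zero       , s≤s () , _)
  no-repetition (suc (suc zero) , suc zero       , s≤s () , _)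
  no-repetition (suc (suc zero) , suc (suc zero) , s≤s (s≤s ()) , _)

module Dense {n : ℕ} (D : Digraph (Fin n)) (ω : Fin n → ℕ)
  (components : ∀ v → HasCardinality (Components (D [ N⁺ D v ])) (ω v))
  (asym : ∀ {u v} → Arc D u v → ¬ Arc D v u)
  (no-triangle : ∀ {u v w} → Arc D u v → Arc D v w → ¬ Arc D w u)
  (dense : ∀ v → n ≤ 2 * (d⁻ D v + ω v)) where

  open Counting D ω components asym no-triangle

  n≤two : ∀ u v → n ≤ d⁻′ u + ω u + (d⁻′ v + ω v)
  n≤two u v = n≤2a∧n≤2b⇒n≤a+b (d⁻′ u + ω u) (d⁻′ v + ω v) (dense′ u) (dense′ v)
    where
    dense′ : ∀ v → n ≤ 2 * (d⁻′ v + ω v)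
    dense′ v = subst (λ d → n ≤ 2 * (d + ω v)) (∣tabulate∣ (λ u → arc D u v)) (dense v)

  avoid : ∀ {u v} → Arc D u v → Avoid (ω u) u v
  avoid u→v = avoiding D (components _) irrefl (∈-tabulate⁺ u→v)

  -- The density condition at both ends bounds n in `around-arc`, and the common terms cancel. The
  -- subtraction in s(v) is moved across the inequality, here and below.
  surplus≤t₁ : ∀ {u v} → Arc D u v → d⁺ v ≤ ω v + t₁ u v
  surplus≤t₁ {u} {v} u→v = +-cancelˡ-≤ (P + d⁻′ v) _ _ (begin
    P + d⁻′ v + d⁺ v               ≡⟨ +-assoc P _ _ ⟩
    P + (d⁻′ v + d⁺ v)             ≡⟨ cong (P +_) (+-comm (d⁻′ v) _) ⟩
    P + (d⁺ v + d⁻′ v)             ≡⟨ +-assoc P _ _ ⟨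
    P + d⁺ v + d⁻′ v               ≤⟨ around-arc u→v (avoid u→v) ⟩
    n + t₁ u v                     ≤⟨ +-monoˡ-≤ _ (n≤two u v) ⟩
    P + (d⁻′ v + ω v) + t₁ u v     ≡⟨ cong (_+ t₁ u v) (+-assoc P _ _) ⟨
    P + d⁻′ v + ω v + t₁ u v       ≡⟨ +-assoc (P + d⁻′ v) _ _ ⟩
    P + d⁻′ v + (ω v + t₁ u v)     ∎)
    where
    open ≤-Reasoning
    P : ℕ
    P = d⁻′ u + ω u

  ω+t₂+t₃≤d⁺ : ∀ {u v} → Arc D u v → ω u + (t₂ u v + t₃ u v) ≤ d⁺ u
  ω+t₂+t₃≤d⁺ {u} {v} u→v =
    subst (_≤ d⁺ u) (+-assoc (ω u) _ _) (inside-out u→v (avoid u→v))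

  -- Both sides count the arcs inside the in-neighbourhood of v, once by
  -- their heads and once by their tails.
  Σt₁≡Σt₂ : ∀ v → sum (λ u → a u v * t₁ u v) ≡ sum (λ u → a u v * t₂ u v)
  Σt₁≡Σt₂ v = begin
    sum (λ u → a u v * t₁ u v)
      ≡⟨ sum-cong-≗ (λ u → *-distribˡ-sum (a u v) (λ x → a x u * a x v)) ⟩
    sum (λ u → sum λ x → a u v * (a x u * a x v))
      ≡⟨ ∑-comm (λ u x → a u v * (a x u * a x v)) ⟩
    sum (λ x → sum λ u → a u v * (a x u * a x v))
      ≡⟨ sum-cong-≗ (λ x → sum-cong-≗ λ u → rotate (a u v) (a x u) (a x v)) ⟩
    sum (λ x → sum λ u → a x v * (a x u * a u v))
      ≡⟨ sum-cong-≗ (λ x → *-distribˡ-sum (a x v) (λ u → a x u * a u v)) ⟨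
    sum (λ x → a x v * t₂ x v) ∎
    where
    open ≡-Reasoning
    rotate : ∀ p q r → p * (q * r) ≡ r * (q * p)
    rotate p q r = begin
      p * (q * r)  ≡⟨ *-comm p _ ⟩
      q * r * p    ≡⟨ cong (_* p) (*-comm q r) ⟩
      r * q * p    ≡⟨ *-assoc r q p ⟩
      r * (q * p)  ∎

  -- The successor makes the bound on the surplus of nonsources positive; `Tight` says that a vertex
  -- reaches it.
  module Maximal (B : ℕ) (bound : ∀ {x v} → Arc D x v → d⁺ v ≤ ω v + suc B) where

    Tight : Fin n → Set
    Tight v = ω v + suc B ≤ d⁺ v

    module _ {v} (tight : Tight v) where

      B<t₁ : ∀ {u} → Arc D u v → suc B ≤ t₁ u v
      B<t₁ u→v = +-cancelˡ-≤ (ω v) _ _ (≤-trans tight (surplus≤t₁ u→v))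

      -- A witness exists because `t₁` is positive. In particular every in-neighbour of a tight
      -- vertex is a nonsource, so `bound` applies to it.
      common-in-neighbour : ∀ {u} → Arc D u v → ∃ λ w → Arc D w u × Arc D w v
      common-in-neighbour {u} u→v =
        map₂ ⟦⟧*⟦⟧-positive (sum-positive (λ x → a x u * a x v) (≤-trans (s≤s z≤n) (B<t₁ u→v)))

      t₂+t₃≤1+B : ∀ {u} → Arc D u v → t₂ u v + t₃ u v ≤ suc B
      t₂+t₃≤1+B {u} u→v = +-cancelˡ-≤ (ω u) _ _
        (≤-trans (ω+t₂+t₃≤d⁺ u→v) (bound (proj₁ (proj₂ (common-in-neighbour u→v)))))

      -- The factor `a u v` restricts the sums to in-neighbours of `v`. The chain from `weightedB`
      -- to the `t₁` sum, which equals that of `weighted₂`, then to `weighted₂₃` and back to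
      -- `weightedB` is a cycle of inequalities, so `sum-squeeze` gives equality in each term.
      weighted₂ weighted₂₃ weightedB : Fin n → ℕ
      weighted₂  u = a u v * t₂ u v
      weighted₂₃ u = a u v * (t₂ u v + t₃ u v)
      weightedB  u = a u v * suc B

      ₂≤₂₃ : ∀ u → weighted₂ u ≤ weighted₂₃ u
      ₂≤₂₃ u = *-monoʳ-≤ (a u v) (m≤m+n _ _)

      ₂₃≤B : ∀ u → weighted₂₃ u ≤ weightedB u
      ₂₃≤B u = ⟦⟧*-mono t₂+t₃≤1+B

      ΣB≤Σ₂ : sum weightedB ≤ sum weighted₂
      ΣB≤Σ₂ = subst (sum weightedB ≤_) (Σt₁≡Σt₂ v) (sum-mono {f = weightedB} λ u → ⟦⟧*-mono B<t₁)

      in-neighbours-tight : ∀ {u} → Arc D u v → Tight u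
      in-neighbours-tight {u} u→v = ≤-trans
        (+-monoʳ-≤ (ω u) (⟦⟧*-cancel u→v
          (sum-squeeze ₂₃≤B (≤-trans ΣB≤Σ₂ (sum-mono ₂≤₂₃)) u)))
        (ω+t₂+t₃≤d⁺ u→v)

      no-common-out-neighbour : ∀ {u w} → Arc D u v → Arc D u w → ¬ Arc D v w
      no-common-out-neighbour {u} {w} u→v u→w v→w = contradiction
        (≤-trans (⟦⟧*⟦⟧-true u→w v→w) (term≤sum (λ x → a u x * a v x) w))
        (≤⇒≯ t₃≤0)
        where
        t₃≤0 : t₃ u v ≤ 0
        t₃≤0 = +-cancelˡ-≤ (t₂ u v) _ _ (subst (t₂ u v + t₃ u v ≤_) (sym (+-identityʳ _))
          (⟦⟧*-cancel u→v (sum-squeeze ₂≤₂₃ (≤-trans (sum-mono ₂₃≤B) ΣB≤Σ₂) u)))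

    no-tight : ∀ {x v} → Arc D x v → ¬ Tight v
    -- The vertex `x` is tight too, so `t₃` vanishes on w → x, although `v` is counted there.
    no-tight x→v tight with w , w→x , w→v ← common-in-neighbour tight x→v =
      no-common-out-neighbour (in-neighbours-tight tight x→v) w→x w→v x→v

  -- Instead of choosing a nonsource of maximal surplus, the proof lowers a common bound by one at a
  -- time, from the trivial `n` down to 0.
  d⁺≤ω-nonsource : ∀ {x v} → Arc D x v → d⁺ v ≤ ω v
  d⁺≤ω-nonsource = descend n λ {_} {v} _ → ≤-trans
    (subst (_≤ n) (∣tabulate∣ (arc D v)) (∣p∣≤n (N⁺ D v))) (m≤n+m n (ω v))
    where
    descend : ∀ B → (∀ {x v} → Arc D x v → d⁺ v ≤ ω v + B) → ∀ {x v} → Arc D x v → d⁺ v ≤ ω v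
    descend zero    bound {v = v} e = subst (d⁺ v ≤_) (+-identityʳ (ω v)) (bound e)
    descend (suc B) bound = descend B λ {_} {v} e →
      ≤-pred (subst (d⁺ v <_) (+-suc (ω v) B) (≰⇒> (Maximal.no-tight B bound e)))

  no-transitive : ∀ {u v w} → Arc D u v → Arc D v w → ¬ Arc D u w
  no-transitive {u} {v} {w} u→v v→w u→w with any? (λ x → T? (arc D x u))
  -- A nonsource has no surplus, so `t₃ u v` is 0, yet it counts `w`.
  ... | yes (_ , x→u) = contradiction 1≤t₃ (≤⇒≯ t₃≤0)
    where
    1≤t₃ : 1 ≤ t₃ u v
    1≤t₃ = ≤-trans (⟦⟧*⟦⟧-true u→w v→w) (term≤sum (λ x → a u x * a v x) w)
    t₃≤0 : t₃ u v ≤ 0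
    t₃≤0 = m+n≤o⇒n≤o (t₂ u v) (+-cancelˡ-≤ (ω u) _ _ (≤-trans (ω+t₂+t₃≤d⁺ u→v)
      (≤-trans (d⁺≤ω-nonsource x→u) (≤-reflexive (sym (+-identityʳ (ω u)))))))
  ... | no source = absurd
    where
    open ≤-Reasoning
    d⁻≤0 : d⁻′ u ≤ 0
    d⁻≤0 = ≮⇒≥ λ 0<d → let x , 0<a = sum-positive (λ x → a x u) 0<d in source (x , ⟦⟧-positive 0<a)
    3≤n : 3 ≤ n
    3≤n = distinct⇒3≤n {x = u} {v} {w} (λ { refl → irrefl u→v }) (λ { refl → irrefl v→w }) (λ { refl → irrefl u→w })
    -- At a source the density condition rests on `ω u` alone, and three distinct vertices then
    -- force a second component.
    2≤ω : 2 ≤ ω u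
    2≤ω = *-cancelˡ-< 2 1 (ω u) (≤-trans 3≤n (begin
      n                        ≤⟨ n≤two u u ⟩
      d⁻′ u + ω u + (d⁻′ u + ω u)
        ≤⟨ +-mono-≤ (+-monoˡ-≤ (ω u) d⁻≤0) (+-monoˡ-≤ (ω u) d⁻≤0) ⟩
      ω u + ω u                ≡⟨ cong (ω u +_) (+-identityʳ _) ⟨
      2 * ω u                  ∎))
    t₁≤d⁻ : ∀ y → t₁ u y ≤ d⁻′ u
    t₁≤d⁻ y = sum-mono {g = λ x → a x u} λ x →
      ≤-trans (*-monoʳ-≤ (a x u) (⟦⟧≤1 (arc D x y))) (≤-reflexive (*-identityʳ (a x u)))
      where
      ⟦⟧≤1 : ∀ b → ⟦ b ⟧ ≤ 1
      ⟦⟧≤1 true  = ≤-refl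
      ⟦⟧≤1 false = z≤n
    -- The arc v → w makes a component nontrivial, so around u → y there are `suc (ω u)` vertices to
    -- count, while `t₁ u y` is 0 at a source. The total exceeds n.
    absurd : T false
    absurd with y , y∈ , A ← avoiding⁺ D (components u) irrefl
                 (∈-tabulate⁺ u→v) (∈-tabulate⁺ u→w) v→w 2≤ω =
      contradiction (begin-strict
        n                                     ≤⟨ n≤two u y ⟩
        d⁻′ u + ω u + (d⁻′ y + ω y)           ≤⟨ +-monoʳ-≤ (d⁻′ u + ω u) (+-monoʳ-≤ (d⁻′ y) (ω≤d⁺ y)) ⟩
        d⁻′ u + ω u + (d⁻′ y + d⁺ y)          ≡⟨ cong (d⁻′ u + ω u +_) (+-comm (d⁻′ y) _) ⟩
        d⁻′ u + ω u + (d⁺ y + d⁻′ y)          ≡⟨ +-assoc (d⁻′ u + ω u) _ _ ⟨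
        d⁻′ u + ω u + d⁺ y + d⁻′ y            <⟨ +-monoˡ-< (d⁻′ y) (+-monoˡ-< (d⁺ y) (+-monoʳ-< (d⁻′ u) (n<1+n (ω u)))) ⟩
        d⁻′ u + suc (ω u) + d⁺ y + d⁻′ y      ≤⟨ around-arc (∈-tabulate⁻ y∈) A ⟩
        n + t₁ u y                            ≤⟨ +-monoʳ-≤ n (≤-trans (t₁≤d⁻ y) d⁻≤0) ⟩
        n + 0                                 ≡⟨ +-identityʳ n ⟩
        n                                     ∎) (<-irrefl refl)

  adjacent : Fin n → Fin n → Bool
  adjacent x y = arc D x y ∨ arc D y x

  -- Of the eight ways to orient a triangle, two are cyclic and six are transitive.
  triangle-free : ∀ {x y z} → T (adjacent x y) → T (adjacent y z) → ¬ T (adjacent x z)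
  triangle-free {x} {y} {z} xy yz xz with Equivalence.to T-∨ xy | Equivalence.to T-∨ yz | Equivalence.to T-∨ xz
  ... | inj₁ x→y | inj₁ y→z | inj₁ x→z = no-transitive x→y y→z x→z
  ... | inj₁ x→y | inj₁ y→z | inj₂ z→x = no-triangle x→y y→z z→x
  ... | inj₁ x→y | inj₂ z→y | inj₁ x→z = no-transitive x→z z→y x→y
  ... | inj₁ x→y | inj₂ z→y | inj₂ z→x = no-transitive z→x x→y z→y
  ... | inj₂ y→x | inj₁ y→z | inj₁ x→z = no-transitive y→x x→z y→z
  ... | inj₂ y→x | inj₁ y→z | inj₂ z→x = no-transitive y→z z→x y→x
  ... | inj₂ y→x | inj₂ z→y | inj₁ x→z = no-triangle y→x x→z z→y
  ... | inj₂ y→x | inj₂ z→y | inj₂ z→x = no-transitive z→y y→x z→x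

  -- Since `ω v` is at most the out-degree, the density condition bounds the total degree.
  min-degree : ∀ v → n ≤ 2 * ∣ tabulate (adjacent v) ∣
  min-degree v = begin
    n                                     ≤⟨ n≤two v v ⟩
    d⁻′ v + ω v + (d⁻′ v + ω v)           ≤⟨ +-mono-≤ below below ⟩
    deg + deg                             ≡⟨ cong (deg +_) (+-identityʳ deg) ⟨
    2 * deg                               ∎
    where
    open ≤-Reasoning
    deg : ℕ
    deg = ∣ tabulate (adjacent v) ∣
    disjoint-∨ : ∀ p q → Disjoint p q → ⟦ q ⟧ + ⟦ p ⟧ ≤ ⟦ p ∨ q ⟧
    disjoint-∨ true  true  pq with () ← pq _ _
    disjoint-∨ true  false pq = ≤-refl
    disjoint-∨ false true  pq = ≤-refl
    disjoint-∨ false false pq = z≤n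
    below : d⁻′ v + ω v ≤ deg
    below = begin
      d⁻′ v + ω v                  ≤⟨ +-monoʳ-≤ (d⁻′ v) (ω≤d⁺ v) ⟩
      d⁻′ v + d⁺ v                 ≡⟨ ∑-distrib-+ (λ x → a x v) (a v) ⟨
      sum (λ x → a x v + a v x)    ≤⟨ sum-mono (λ x → disjoint-∨ (arc D v x) (arc D x v) asym) ⟩
      sum (⟦_⟧ ∘ adjacent v)       ≡⟨ ∣tabulate∣ (adjacent v) ⟨
      deg                          ∎

-- Complete bipartite graphs from a subset and its complement.

split : ∀ {n} (S : Subset n) → Fin n ↔ (Fin ∣ S ∣ ⊎ Fin ∣ ∁ S ∣)
split []            = mk↔ₛ′ (λ ()) (λ { (inj₁ ()) ; (inj₂ ()) }) (λ { (inj₁ ()) ; (inj₂ ()) }) (λ ())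
split (inside ∷ S)  = mk↔ₛ′ f g fg gf
  where
  open Inverse (split S)
  f : _ → Fin (suc ∣ S ∣) ⊎ Fin ∣ ∁ S ∣
  f zero    = inj₁ zero
  f (suc x) = ⊎-map suc id (to x)
  g : Fin (suc ∣ S ∣) ⊎ Fin ∣ ∁ S ∣ → _
  g (inj₁ zero)    = zero
  g (inj₁ (suc i)) = suc (from (inj₁ i))
  g (inj₂ j)       = suc (from (inj₂ j))
  fg : ∀ y → f (g y) ≡ y
  fg (inj₁ zero)    = refl
  fg (inj₁ (suc i)) = cong (⊎-map suc id) (strictlyInverseˡ (inj₁ i))
  fg (inj₂ j)       = cong (⊎-map suc id) (strictlyInverseˡ (inj₂ j))
  gf : ∀ x → g (f x) ≡ x
  gf zero    = refl
  gf (suc x) = trans (g-suc (to x)) (cong suc (strictlyInverseʳ x))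
    where
    g-suc : ∀ y → g (⊎-map suc id y) ≡ suc (from y)
    g-suc (inj₁ _) = refl
    g-suc (inj₂ _) = refl
split (outside ∷ S) = mk↔ₛ′ f g fg gf
  where
  open Inverse (split S)
  f : _ → Fin ∣ S ∣ ⊎ Fin (suc ∣ ∁ S ∣)
  f zero    = inj₂ zero
  f (suc x) = ⊎-map id suc (to x)
  g : Fin ∣ S ∣ ⊎ Fin (suc ∣ ∁ S ∣) → _
  g (inj₁ i)       = suc (from (inj₁ i))
  g (inj₂ zero)    = zero
  g (inj₂ (suc j)) = suc (from (inj₂ j))
  fg : ∀ y → f (g y) ≡ y
  fg (inj₁ i)       = cong (⊎-map id suc) (strictlyInverseˡ (inj₁ i))
  fg (inj₂ zero)    = refl
  fg (inj₂ (suc j)) = cong (⊎-map id suc) (strictlyInverseˡ (inj₂ j))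
  gf : ∀ x → g (f x) ≡ x
  gf zero    = refl
  gf (suc x) = trans (g-suc (to x)) (cong suc (strictlyInverseʳ x))
    where
    g-suc : ∀ y → g (⊎-map id suc y) ≡ suc (from y)
    g-suc (inj₁ _) = refl
    g-suc (inj₂ _) = refl

Side : ∀ {n} (S : Subset n) → Fin n → Fin ∣ S ∣ ⊎ Fin ∣ ∁ S ∣ → Set
Side S x = [ (λ _ → x ∈ S) , (λ _ → x ∉ S) ]′

split-side : ∀ {n} (S : Subset n) x → Side S x (Inverse.to (split S) x)
split-side (inside ∷ S) zero    = here
split-side (inside ∷ S) (suc x) with Inverse.to (split S) x | split-side S x
... | inj₁ _ | x∈S = there x∈S
... | inj₂ _ | x∉S = λ { (there x∈S) → x∉S x∈S }
split-side (outside ∷ S) zero    = λ ()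
split-side (outside ∷ S) (suc x) with Inverse.to (split S) x | split-side S x
... | inj₁ _ | x∈S = there x∈S
... | inj₂ _ | x∉S = λ { (there x∈S) → x∉S x∈S }

module _ {n : ℕ} (G : SimpleGraph (Fin n)) where

  open SimpleGraph G

  record CompleteBipartition (S : Subset n) : Set where
    field
      inside-independent  : ∀ {x y} → x ∈ S → y ∈ S → ¬ Adj x y
      outside-independent : ∀ {x y} → x ∉ S → y ∉ S → ¬ Adj x y
      across              : ∀ {x y} → x ∈ S → y ∉ S → Adj x y

  bipartition⇒≅K : ∀ {S} → CompleteBipartition S → G ≅ K ∣ S ∣ ∣ ∁ S ∣
  bipartition⇒≅K {S} P = record { vertices = split S ; adj = adj }
    where
    open CompleteBipartition P
    adj : ∀ x y → Adj x y ⇔ SimpleGraph.Adj (K ∣ S ∣ ∣ ∁ S ∣) (Inverse.to (split S) x) (Inverse.to (split S) y)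
    adj x y with Inverse.to (split S) x | split-side S x | Inverse.to (split S) y | split-side S y
    ... | inj₁ _ | x∈S | inj₁ _ | y∈S = mk⇔ (inside-independent x∈S y∈S) (λ ())
    ... | inj₁ _ | x∈S | inj₂ _ | y∉S = mk⇔ _ (λ _ → across x∈S y∉S)
    ... | inj₂ _ | x∉S | inj₁ _ | y∈S = mk⇔ _ (λ _ → adj-sym (across y∈S x∉S))
    ... | inj₂ _ | x∉S | inj₂ _ | y∉S = mk⇔ (outside-independent x∉S y∉S) (λ ())

-- Triangle-free graphs of minimum degree at least n/2.

module _ {n : ℕ} (e : Fin n → Fin n → Bool)
  (e-sym : ∀ {x y} → T (e x y) → T (e y x))
  (triangle-free : ∀ {x y z} → T (e x y) → T (e y z) → ¬ T (e x z)) where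

  graph : SimpleGraph (Fin n)
  -- A loop would be a degenerate triangle.
  graph = record { Adj = λ x y → T (e x y) ; adj-sym = e-sym ; adj-irrefl = λ { refl xx → triangle-free xx xx xx } }

  -- The neighbours of any `x` in S = N(q) lie outside S, which has at most n/2 vertices, so they
  -- are all of the complement. Two vertices outside S then share the neighbour `p` and cannot be
  -- adjacent. The degree of `p` makes the complement no smaller than S.
  neighbourhood-bipartition : (∀ v → n ≤ 2 * ∣ tabulate (e v) ∣) → ∀ {p q} → T (e q p) →
    CompleteBipartition graph (tabulate (e q)) ×
    ∣ tabulate (e q) ∣ ≡ ∣ ∁ (tabulate (e q)) ∣
  neighbourhood-bipartition min-degree {p} {q} qp = record
    { inside-independent  = λ x∈S y∈S xy → N⊆∁S x∈S (∈-tabulate⁺ xy) y∈S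
    ; outside-independent = λ x∉S y∉S xy → triangle-free (across p∈S x∉S) xy (across p∈S y∉S)
    ; across              = across
    } , ≤-antisym ∣S∣≤∣∁S∣ (∣∁S∣≤ (min-degree q))
    where
    S : Subset n
    S = tabulate (e q)
    p∈S : p ∈ S
    p∈S = ∈-tabulate⁺ qp
    N⊆∁S : ∀ {x} → x ∈ S → ∀ {y} → y ∈ tabulate (e x) → y ∉ S
    N⊆∁S x∈S y∈N y∈S = triangle-free (∈-tabulate⁻ x∈S) (∈-tabulate⁻ y∈N) (∈-tabulate⁻ y∈S)
    ∣∁S∣≤ : ∀ {m} → n ≤ 2 * m → ∣ ∁ S ∣ ≤ m
    ∣∁S∣≤ {m} n≤2m = subst (_≤ m) (sym (∣∁p∣≡n∸∣p∣ S))
      (m≤n+o⇒m∸n≤o n ∣ S ∣ (n≤2a∧n≤2b⇒n≤a+b ∣ S ∣ m (min-degree q) n≤2m))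
    across : ∀ {x y} → x ∈ S → y ∉ S → T (e x y)
    across {x} x∈S y∉S = ∈-tabulate⁻ (⊆∧≥⇒⊇ (λ y∈N → x∉p⇒x∈∁p (N⊆∁S x∈S y∈N)) (∣∁S∣≤ (min-degree x)) (x∉p⇒x∈∁p y∉S))
    ∣S∣≤∣∁S∣ : ∣ S ∣ ≤ ∣ ∁ S ∣
    ∣S∣≤∣∁S∣ = +-cancelʳ-≤ ∣ ∁ S ∣ _ _ (begin
      ∣ S ∣ + ∣ ∁ S ∣              ≡⟨ cong (∣ S ∣ +_) (∣∁p∣≡n∸∣p∣ S) ⟩
      ∣ S ∣ + (n ∸ ∣ S ∣)          ≡⟨ m+[n∸m]≡n (∣p∣≤n S) ⟩
      n                            ≤⟨ n≤2a∧n≤2b⇒n≤a+b ∣ N ∣ ∣ N ∣ (min-degree p) (min-degree p) ⟩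
      ∣ N ∣ + ∣ N ∣                ≤⟨ +-mono-≤ ∣N∣≤ ∣N∣≤ ⟩
      ∣ ∁ S ∣ + ∣ ∁ S ∣            ∎)
      where
      open ≤-Reasoning
      N : Subset n
      N = tabulate (e p)
      ∣N∣≤ : ∣ N ∣ ≤ ∣ ∁ S ∣
      ∣N∣≤ = p⊆q⇒∣p∣≤∣q∣ λ y∈N → x∉p⇒x∈∁p (N⊆∁S p∈S y∈N)

balanced-bipartition : ∀ {n} (e : Fin n → Fin n → Bool)
  (e-sym : ∀ {x y} → T (e x y) → T (e y x))
  (triangle-free : ∀ {x y z} → T (e x y) → T (e y z) → ¬ T (e x z)) →
  (∀ v → n ≤ 2 * ∣ tabulate (e v) ∣) →
  ∃ λ S → CompleteBipartition (graph e e-sym triangle-free) S × ∣ S ∣ ≡ ∣ ∁ S ∣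
-- Without vertices there is no edge to start from; otherwise the degree bound gives vertex `zero` a
-- neighbour.
balanced-bipartition {zero} _ _ _ _ = [] , record
  { inside-independent  = λ { {()} }
  ; outside-independent = λ { {()} }
  ; across              = λ { {()} }
  } , refl
balanced-bipartition {suc n} e e-sym triangle-free min-degree =
  tabulate (e zero) , neighbourhood-bipartition e e-sym triangle-free min-degree (⟦⟧-positive (proj₂ neighbour))
  where
  0<deg : 0 < ∣ tabulate (e zero) ∣
  0<deg = *-cancelˡ-< 2 0 _ (≤-trans (s≤s z≤n) (min-degree zero))
  neighbour : ∃ λ p → 0 < ⟦ e zero p ⟧
  neighbour = sum-positive (⟦_⟧ ∘ e zero) (subst (0 <_) (∣tabulate∣ (e zero)) 0<deg)

-- From the balanced bipartition back to the orientation.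

theorem5 : ∀ (n : ℕ) (D : Digraph (Fin n)) → Oriented D →
    (∀ v → n ≤ 2 * (d⁻ D v + ω⁺ D v)) →
    HasDirectedTriangle D ⊎ (2 ∣ n × OrientationOfCopy D (K (n / 2) (n / 2)))
theorem5 n D (G , orientation) dense
  with any? (λ u → any? λ v → any? λ w → T? (arc D u v) ×-dec T? (arc D v w) ×-dec T? (arc D w u))
... | yes (u , v , w , uv , vw , wu) =
  inj₁ (u , v , w , (arc⇒≢ uv , arc⇒≢ vw , arc⇒≢ wu) , uv , vw , wu)
  where
  open _IsOrientationOf_ orientation
  arc⇒≢ : ∀ {x y} → Arc D x y → x ≢ y
  arc⇒≢ xy x≡y = SimpleGraph.adj-irrefl G x≡y (arc⇒edge xy)
... | no acyclic = inj₂ (divides ∣ S ∣ n≡∣S∣*2 , underlying , record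
    { arc⇒edge = λ uv → Equivalence.from T-∨ (inj₁ uv)
    ; edge⇒arc = λ uv → ⊎-map (λ uv → uv , asym uv) (λ vu → asym vu , vu) (Equivalence.to T-∨ uv)
    } , subst₂ (λ k l → underlying ≅ K k l) (sym n/2≡∣S∣) (trans (sym ∣S∣≡∣∁S∣) (sym n/2≡∣S∣))
          (bipartition⇒≅K underlying bipartition))
  where
  asym : ∀ {u v} → Arc D u v → ¬ Arc D v u
  asym uv vu = [ (λ (_ , ¬vu) → ¬vu vu) , (λ (¬uv , _) → ¬uv uv) ]′
    (_IsOrientationOf_.edge⇒arc orientation (_IsOrientationOf_.arc⇒edge orientation uv))
  open Dense D (ω⁺ D) (λ v → proj₂ (outComponents D v)) asym (λ uv vw wu → acyclic (_ , _ , _ , uv , vw , wu)) dense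
  adjacent-sym : ∀ {x y} → T (adjacent x y) → T (adjacent y x)
  adjacent-sym {x} {y} = Equivalence.from (T-∨ {arc D y x}) ∘ swap ∘ Equivalence.to (T-∨ {arc D x y})
  -- Rebuilt from the arcs of `D`, so that adjacency is Boolean and neighbourhoods can be counted.
  underlying : SimpleGraph (Fin n)
  underlying = graph adjacent adjacent-sym triangle-free
  balanced : ∃ λ S → CompleteBipartition underlying S × ∣ S ∣ ≡ ∣ ∁ S ∣
  balanced = balanced-bipartition adjacent adjacent-sym triangle-free min-degree
  S : Subset n
  S = proj₁ balanced
  bipartition : CompleteBipartition underlying S
  bipartition = proj₁ (proj₂ balanced)
  ∣S∣≡∣∁S∣ : ∣ S ∣ ≡ ∣ ∁ S ∣
  ∣S∣≡∣∁S∣ = proj₂ (proj₂ balanced)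
  n≡∣S∣*2 : n ≡ ∣ S ∣ * 2
  n≡∣S∣*2 = begin
    n                       ≡⟨ m+[n∸m]≡n (∣p∣≤n S) ⟨
    ∣ S ∣ + (n ∸ ∣ S ∣)     ≡⟨ cong (∣ S ∣ +_) (∣∁p∣≡n∸∣p∣ S) ⟨
    ∣ S ∣ + ∣ ∁ S ∣         ≡⟨ cong (∣ S ∣ +_) ∣S∣≡∣∁S∣ ⟨
    ∣ S ∣ + ∣ S ∣           ≡⟨ cong (∣ S ∣ +_) (+-identityʳ ∣ S ∣) ⟨
    2 * ∣ S ∣               ≡⟨ *-comm 2 ∣ S ∣ ⟩
    ∣ S ∣ * 2               ∎
    where open ≡-Reasoning
  n/2≡∣S∣ : n / 2 ≡ ∣ S ∣
  n/2≡∣S∣ = trans (cong (_/ 2) n≡∣S∣*2) (m*n/n≡m ∣ S ∣ 2)
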